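{- There is a deterministic protocol for the ad-hoc radio network model (defined in the context) such that, for every acyclic directed graph $G$ with $n$ vertices, labels from $\{0,1,\dots,n-1\}$, and a designated target node $t$ reachable from all other nodes, the protocol completes information gathering on $G$ within $O(n^{1.5}\log^3 n)$ time steps.
   Context: Ad-hoc radio network model: the network is a directed graph $G$ on $n$ nodes, each node having a distinct label from $\{0,1,\dots,n-1\}$; nodes know $n$ and their own label, but the topology of $G$ is unknown to them. Time proceeds in synchronous discrete steps $0,1,2,\dots$, and all nodes start the protocol simultaneously at step $0$. In each step each node is either transmitting (sending one message) or receiving. If node $u$ transmits in a step, the message reaches all out-neighbors of $u$; a receiving node $v$ receives a message in that step if and only if exactly one in-neighbor of $v$ transmits in that step; if two or more in-neighbors transmit, $v$ receives nothing and cannot distinguish this from silence (no collision detection). A transmitting node gets no feedback about whether its transmission was received. Messages have unbounded size (a node may, e.g., include all rumors it knows). A deterministic protocol specifies, for each node, whether and what to transmit at each step as a function of its label, $n$, and the messages it has received so far. Information gathering: each node initially holds a unique piece of information (its rumor); there is a designated target node $t$ reachable by directed paths from all nodes; the task is completed when $t$ holds all $n$ rumors. The running time is the number of steps until completion, in the worst case over all such graphs and labelings. -}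

module Defs where

open import Data.Nat using (ℕ; zero; suc)
open import Data.Fin using (Fin; toℕ)
open import Data.Bool using (Bool; true; false; if_then_else_; _∧_; T)
open import Data.Maybe using (Maybe; just; nothing)
open import Data.List using (List; []; _∷_; filterᵇ; allFin)
open import Data.Sum using (_⊎_)
open import Relation.Nullary using (¬_)
open import Relation.Binary.PropositionalEquality using (_≡_)
open import Relation.Binary.Construct.Closure.ReflexiveTransitive using (Star)

-- A directed graph on the node set Fin n (nodes are identified with their
-- labels 0..n-1):  G u v = true  iff there is an edge u → v.
Graph : ℕ → Set
Graph n = Fin n → Fin n → Bool

Edge : ∀ {n} → Graph n → Fin n → Fin n → Set
Edge G u v = T (G u v)

Reach : ∀ {n} → Graph n → Fin n → Fin n → Set
Reach G = Star (Edge G)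

-- acyclic: no directed cycle (a cycle through an edge u → v would be a
-- path back from v to u; self-loops are cycles too)
Acyclic : ∀ {n} → Graph n → Set
Acyclic G = ∀ u v → Edge G u v → ¬ Reach G v u

-- Messages (unbounded size, full information): a transmitted message
-- consists of the sender's label together with the sender's whole history
-- of received messages.  Any message of any protocol is a function of
-- exactly this data, so full-information messages lose no generality.
data Msg : Set where
  msg : (sender : ℕ) → (history : List (Maybe Msg)) → Msg

-- History of a node: what it received in steps 0,1,...,s-1, most recent
-- first ('nothing' = silence / collision / was transmitting).  Its length is
-- the current step number.
History : Set
History = List (Maybe Msg)

-- A deterministic protocol: whether node with label v, knowing n, transmits
-- in the current step, as a function of its history.
Protocol : Set
Protocol = (n : ℕ) → Fin n → History → Bool

private
  single : ∀ {A : Set} → List A → Maybe A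
  single (x ∷ []) = just x
  single _        = nothing

  mapMaybe : ∀ {A B : Set} → (A → B) → Maybe A → Maybe B
  mapMaybe f (just x) = just (f x)
  mapMaybe f nothing  = nothing

-- hist P G s v : history of node v at the beginning of step s
hist : Protocol → ∀ {n} → Graph n → ℕ → Fin n → History
hist P G zero v = []
hist P {n} G (suc s) v =
  (if P n v (hist P G s v)
     then nothing
     else mapMaybe (λ u → msg (toℕ u) (hist P G s u))
            (single (filterᵇ (λ u → G u v ∧ P n u (hist P G s u)) (allFin n))))
  ∷ hist P G s v

-- rumor of node with label x is contained in a history: received a message
-- from x, or received a message whose sender's history contained it.
data Contains (x : ℕ) : History → Set where
  here  : ∀ {h rest} → Contains x (just (msg x h) ∷ rest)
  deep  : ∀ {y h rest} → Contains x h → Contains x (just (msg y h) ∷ rest)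
  later : ∀ {m rest} → Contains x rest → Contains x (m ∷ rest)

Holds : Protocol → ∀ {n} → Graph n → ℕ → Fin n → Fin n → Set
Holds P G s v u = (u ≡ v) ⊎ Contains (toℕ u) (hist P G s v)

Gathered : Protocol → ∀ {n} → Graph n → Fin n → ℕ → Set
Gathered P G t s = ∀ u → Holds P G s t u

{-# OPTIONS --safe #-}
module Submission where

open import Defs
open import Data.Nat
open import Data.Nat.Properties
open import Data.Nat.Divisibility using (_∣_; _∣?_; divides; divides-refl; ∣-refl; ∣⇒≤; ∣m⇒∣m*n; ∣n⇒∣m*n)
open import Data.Nat.DivMod
open import Data.Nat.Induction using (<-rec)
open import Data.Nat.ListAction using (product)
open import Data.Nat.Logarithm using (⌈log₂_⌉; ⌈log₂⌉-mono-≤; ⌈log₂⌈n/2⌉⌉≡⌈log₂n⌉∸1; ⌈log₂2^n⌉≡n)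
open import Data.Nat.Tactic.RingSolver using (solve-∀)
open import Data.Bool using (true; false; T; T?; _∧_)
open import Data.Bool.Properties using (T-∧)
open import Data.Empty using (⊥)
open import Data.Fin using (Fin; toℕ; fromℕ<)
open import Data.Fin.Induction using (spo-wellFounded)
open import Data.Fin.Properties using (toℕ<n; toℕ-fromℕ<; toℕ-injective; any?)
open import Data.List using (List; []; _∷_; map; length; filter; filterᵇ; drop; allFin)
open import Data.List.Membership.Propositional using (_∈_; find; lose)
open import Data.List.Membership.Propositional.Properties using (∈-allFin; ∈-filter⁺; ∈-filter⁻; ∈-map⁺)
open import Data.List.Properties using (filter-accept; filter-reject; filter-none; length-map; length-tabulate; length-filter)
open import Data.List.Relation.Unary.All as All using (All; []; _∷_)
open import Data.List.Relation.Unary.All.Properties using (map⁺)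
open import Data.List.Relation.Unary.AllPairs using (_∷_)
open import Data.List.Relation.Unary.Any as Any using (Any; here; there)
open import Data.List.Relation.Unary.Unique.Propositional using (Unique)
open import Data.List.Relation.Unary.Unique.Propositional.Properties using (allFin⁺)
open import Data.Maybe using (Maybe; just; nothing)
import Data.Maybe.Relation.Unary.All as MAll
import Data.Maybe.Relation.Unary.Any as MAny
open import Data.Product using (Σ; ∃; _×_; _,_; proj₁; proj₂)
open import Data.Sum using (_⊎_; inj₁; inj₂; [_,_]′)
open import Function using (Equivalence)
open import Induction.WellFounded using (Acc; acc; WellFounded)
open import Relation.Binary.Construct.Closure.ReflexiveTransitive using (Star; ε; _◅_)
open import Relation.Binary.Construct.Closure.Transitive using (TransClosure; [_]; _∷_; wellFounded⁻; _++_)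
open import Relation.Binary.PropositionalEquality hiding (J; [_])
open import Relation.Binary.Structures using (IsStrictPartialOrder)
open import Relation.Nullary using (¬_; Dec; yes; no; contradiction; ¬?)
open import Relation.Nullary.Decidable using (_×-dec_; _⊎-dec_; ⌊_⌋; toWitness; fromWitness)
open import Relation.Unary using (Decidable)

-- In the first n steps the nodes transmit in the order of their labels, so every node
-- learns its in-neighbours.  From then on a node transmits only once it is complete,
-- i.e. has heard from each in-neighbour after step n; a message then carries the
-- rumours of all ancestors of its sender, and the target need only become complete.
--
-- The steps are interleaved into a round robin and selectors of strength 2^j.  The
-- j-th selector has period O(4^j log³ n), and a node uses it only during one period
-- after its completion.  If p waits for its in-neighbour v much longer than this
-- period, the selector failed, so at least 2^j nodes became complete within one period
-- of v.  Along the chain of last-heard in-neighbours ending in the target these groups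
-- of nodes are disjoint, so there are at most n / 2^j such delays, and summing
-- (n / 2^j) · 4^(j+1) log³ n over 2^j ≤ √n gives the bound.
--
-- A selector lets v transmit when v mod m = a, for all m up to 2M + 1 and all residues a.
-- If k nodes together hid v under every m, the product of their distances to v, which
-- is at most n^k, would be a common multiple of 1, …, 2M + 1, hence at least 2^M
-- (Nair's bound).

-- Common multiples of 1, …, 2m + 1

-- lattice i k is the binomial coefficient (i + k) C i, counted as lattice paths.
lattice : ℕ → ℕ → ℕ
lattice zero    k       = 1
lattice (suc i) zero    = 1
lattice (suc i) (suc k) = lattice i (suc k) + lattice (suc i) k

lattice-zeroʳ : ∀ i → lattice i 0 ≡ 1
lattice-zeroʳ zero    = refl
lattice-zeroʳ (suc i) = refl

lattice-sym : ∀ i k → lattice i k ≡ lattice k i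
lattice-sym zero    k       = sym (lattice-zeroʳ k)
lattice-sym (suc i) zero    = refl
lattice-sym (suc i) (suc k) = begin
  lattice i (suc k) + lattice (suc i) k ≡⟨ cong₂ _+_ (lattice-sym i (suc k)) (lattice-sym (suc i) k) ⟩
  lattice (suc k) i + lattice k (suc i) ≡⟨ +-comm (lattice (suc k) i) _ ⟩
  lattice k (suc i) + lattice (suc k) i ∎
  where open ≡-Reasoning

-- The absorption identity for binomial coefficients, from Pascal's rule; it makes neighbouring
-- entries of `leibniz` proportional.
lattice-absorb : ∀ i k → suc i * lattice (suc i) k ≡ suc (i + k) * lattice i k
lattice-absorb i zero = cong₂ (λ a b → suc a * b) (sym (+-identityʳ i)) (sym (lattice-zeroʳ i))
lattice-absorb zero (suc k) = begin
  1 * (1 + lattice 1 k)     ≡⟨ shift (lattice 1 k) ⟩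
  1 + 1 * lattice 1 k       ≡⟨ cong suc (lattice-absorb 0 k) ⟩
  1 + suc k * 1             ∎
  where
  open ≡-Reasoning
  shift : ∀ x → 1 * (1 + x) ≡ 1 + 1 * x
  shift = solve-∀
lattice-absorb (suc i) (suc k) = begin
  suc (suc i) * (lattice (suc i) (suc k) + lattice (suc (suc i)) k)
    ≡⟨ *-distribˡ-+ (suc (suc i)) (lattice (suc i) (suc k)) _ ⟩
  suc (suc i) * lattice (suc i) (suc k) + suc (suc i) * lattice (suc (suc i)) k
    ≡⟨ cong (suc (suc i) * lattice (suc i) (suc k) +_) (lattice-absorb (suc i) k) ⟩
  suc (suc i) * (x + y) + suc (suc i + k) * y
    ≡⟨ e1 i k x y ⟩
  suc i * (x + y) + (x + suc (suc (suc (i + k))) * y)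
    ≡⟨ cong (_+ (x + suc (suc (suc (i + k))) * y)) (lattice-absorb i (suc k)) ⟩
  suc (i + suc k) * x + (x + suc (suc (suc (i + k))) * y)
    ≡⟨ e2 i k x y ⟩
  suc (suc i + suc k) * (x + y) ∎
  where
  open ≡-Reasoning
  x = lattice i (suc k)
  y = lattice (suc i) k
  e1 : ∀ i k x y → suc (suc i) * (x + y) + suc (suc i + k) * y ≡ suc i * (x + y) + (x + suc (suc (suc (i + k))) * y)
  e1 = solve-∀
  e2 : ∀ i k x y → suc (i + suc k) * x + (x + suc (suc (suc (i + k))) * y) ≡ suc (suc i + suc k) * (x + y)
  e2 = solve-∀

-- Pascal's rule splits a central entry into two equal ones, each at least the previous central
-- entry.
2^m≤lattice : ∀ m → 2 ^ m ≤ lattice m m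
2^m≤lattice zero    = ≤-refl
2^m≤lattice (suc m) = begin
  2 * 2 ^ m                             ≤⟨ *-monoʳ-≤ 2 (2^m≤lattice m) ⟩
  2 * lattice m m                       ≡⟨ cong (lattice m m +_) (+-identityʳ _) ⟩
  lattice m m + lattice m m             ≤⟨ +-mono-≤ (step m m) (≤-trans (step m m) (≤-reflexive (lattice-sym m (suc m)))) ⟩
  lattice m (suc m) + lattice (suc m) m ∎
  where
  open ≤-Reasoning
  step : ∀ i k → lattice i k ≤ lattice i (suc k)
  step zero    k = ≤-refl
  step (suc i) k = m≤n+m _ (lattice i (suc k))

-- The reciprocals of the entries form Leibniz' harmonic triangle:
-- 1 / leibniz i k = 1 / leibniz i (suc k) + 1 / leibniz (suc i) k.
leibniz : ℕ → ℕ → ℕ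
leibniz i k = suc (i + k) * lattice i k

leibniz-stepˡ : ∀ i k → suc i * leibniz (suc i) k ≡ suc (suc (i + k)) * leibniz i k
leibniz-stepˡ i k = begin
  suc i * (suc (suc i + k) * lattice (suc i) k) ≡⟨ e i k (lattice (suc i) k) ⟩
  suc (suc (i + k)) * (suc i * lattice (suc i) k) ≡⟨ cong (suc (suc (i + k)) *_) (lattice-absorb i k) ⟩
  suc (suc (i + k)) * leibniz i k ∎
  where
  open ≡-Reasoning
  e : ∀ i k x → suc i * (suc (suc i + k) * x) ≡ suc (suc (i + k)) * (suc i * x)
  e = solve-∀

leibniz-sym : ∀ i k → leibniz i k ≡ leibniz k i
leibniz-sym i k = cong₂ (λ a b → suc a * b) (+-comm i k) (lattice-sym i k)

leibniz-stepʳ : ∀ i k → suc k * leibniz i (suc k) ≡ suc (suc (i + k)) * leibniz i k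
leibniz-stepʳ i k = begin
  suc k * leibniz i (suc k)       ≡⟨ cong (suc k *_) (leibniz-sym i (suc k)) ⟩
  suc k * leibniz (suc k) i       ≡⟨ leibniz-stepˡ k i ⟩
  suc (suc (k + i)) * leibniz k i ≡⟨ cong₂ (λ a b → suc (suc a) * b) (+-comm k i) (leibniz-sym k i) ⟩
  suc (suc (i + k)) * leibniz i k ∎
  where open ≡-Reasoning

-- Scaled by `suc i * suc k`, both sides become the square of `suc (suc (i + k)) * leibniz i k`,
-- since `suc i + suc k` equals that factor.
harmonic : ∀ i k → leibniz i k * leibniz i (suc k) + leibniz i k * leibniz (suc i) k
                 ≡ leibniz (suc i) k * leibniz i (suc k)
harmonic i k = *-cancelˡ-≡ _ _ (suc i * suc k) (begin
  suc i * suc k * (x * y + x * z)             ≡⟨ e1 i k x y z ⟩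
  suc i * x * (suc k * y) + suc k * x * (suc i * z)
    ≡⟨ cong₂ (λ a b → suc i * x * a + suc k * x * b) (leibniz-stepʳ i k) (leibniz-stepˡ i k) ⟩
  suc i * x * (suc (suc (i + k)) * x) + suc k * x * (suc (suc (i + k)) * x) ≡⟨ e2 i k x ⟩
  suc (suc (i + k)) * x * (suc (suc (i + k)) * x) ≡⟨ cong₂ _*_ (leibniz-stepˡ i k) (leibniz-stepʳ i k) ⟨
  suc i * z * (suc k * y)                     ≡⟨ e3 i k y z ⟩
  suc i * suc k * (z * y)                     ∎)
  where
  open ≡-Reasoning
  x = leibniz i k
  y = leibniz i (suc k)
  z = leibniz (suc i) k
  e1 : ∀ i k x y z → suc i * suc k * (x * y + x * z) ≡ suc i * x * (suc k * y) + suc k * x * (suc i * z)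
  e1 = solve-∀
  e2 : ∀ i k x → suc i * x * (suc (suc (i + k)) * x) + suc k * x * (suc (suc (i + k)) * x)
               ≡ suc (suc (i + k)) * x * (suc (suc (i + k)) * x)
  e2 = solve-∀
  e3 : ∀ i k y z → suc i * z * (suc k * y) ≡ suc i * suc k * (z * y)
  e3 = solve-∀

1≤lattice : ∀ i k → 1 ≤ lattice i k
1≤lattice zero    k       = ≤-refl
1≤lattice (suc i) zero    = ≤-refl
1≤lattice (suc i) (suc k) = ≤-trans (1≤lattice i (suc k)) (m≤m+n _ _)

-- The hypothesis says 1 / x = 1 / y + 1 / z, so D / z = D / x − D / y is an integer.
harmonic-∣ : ∀ {D x y z} .{{_ : NonZero x}} .{{_ : NonZero y}} → x * y + x * z ≡ z * y → x ∣ D → y ∣ D → z ∣ D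
harmonic-∣ {D} {x} {y} {z} eq (divides p D≡px) (divides q D≡qy) =
  divides (p ∸ q) (*-cancelʳ-≡ D _ (x * y) {{m*n≢0 x y}} (begin
    D * (x * y)                               ≡⟨ m+n∸n≡m (D * (x * y)) (D * (x * z)) ⟨
    D * (x * y) + D * (x * z) ∸ D * (x * z)   ≡⟨ cong (_∸ D * (x * z)) (*-distribˡ-+ D (x * y) (x * z)) ⟨
    D * (x * y + x * z) ∸ D * (x * z)         ≡⟨ cong (λ a → D * a ∸ D * (x * z)) eq ⟩
    D * (z * y) ∸ D * (x * z)                 ≡⟨ cong₂ (λ a b → a * (z * y) ∸ b * (x * z)) D≡px D≡qy ⟩
    p * x * (z * y) ∸ q * y * (x * z)         ≡⟨ cong₂ _∸_ (e1 p x y z) (e2 q x y z) ⟩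
    p * (z * (x * y)) ∸ q * (z * (x * y))     ≡⟨ *-distribʳ-∸ (z * (x * y)) p q ⟨
    (p ∸ q) * (z * (x * y))                   ≡⟨ *-assoc (p ∸ q) z (x * y) ⟨
    (p ∸ q) * z * (x * y)                     ∎))
  where
  open ≡-Reasoning
  e1 : ∀ p x y z → p * x * (z * y) ≡ p * (z * (x * y))
  e1 = solve-∀
  e2 : ∀ q x y z → q * y * (x * z) ≡ q * (z * (x * y))
  e2 = solve-∀

leibniz≢0 : ∀ i k → NonZero (leibniz i k)
leibniz≢0 i k = m*n≢0 (suc (i + k)) (lattice i k) {{_}} {{>-nonZero (1≤lattice i k)}}

-- Row 0 lists the numbers 1, ..., N themselves; `harmonic-∣` reaches an entry of the next row from
-- two adjacent entries of the row before.
leibniz-∣ : ∀ {N D} → (∀ m → m < N → suc m ∣ D) → ∀ i k → i + k < N → leibniz i k ∣ D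
leibniz-∣ multiple zero    k lt rewrite *-identityʳ k = multiple k lt
leibniz-∣ {N} {D} multiple (suc i) k lt =
  harmonic-∣ {{leibniz≢0 i k}} {{leibniz≢0 i (suc k)}} (harmonic i k)
    (leibniz-∣ multiple i k (<-trans (n<1+n _) lt))
    (leibniz-∣ multiple i (suc k) (subst (_< N) (sym (+-suc i k)) lt))

2^m≤common-multiple : ∀ m {D} .{{_ : NonZero D}} → (∀ a → a < suc (2 * m) → suc a ∣ D) → 2 ^ m ≤ D
2^m≤common-multiple m {D} multiple = begin
  2 ^ m         ≤⟨ 2^m≤lattice m ⟩
  lattice m m   ≤⟨ m≤n*m (lattice m m) (suc (m + m)) ⟩
  leibniz m m   ≤⟨ ∣⇒≤ (leibniz-∣ multiple m m (s≤s (≤-reflexive (cong (m +_) (sym (+-identityʳ m)))))) ⟩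
  D             ∎
  where open ≤-Reasoning

-- Moduli that isolate a label

module _ {n ℓ : ℕ} (n≤2^ℓ : n ≤ 2 ^ ℓ) {x : ℕ} (x<n : x < n) where

  -- The maximum with 1 keeps the product positive when `x` itself occurs among the labels.
  gap : ℕ → ℕ
  gap y = 1 ⊔ ∣ x - y ∣

  product-gap≢0 : ∀ ys → NonZero (product (map gap ys))
  product-gap≢0 []       = _
  product-gap≢0 (y ∷ ys) = m*n≢0 (gap y) _ {{>-nonZero (m≤m⊔n 1 ∣ x - y ∣)}} {{product-gap≢0 ys}}

  product-gap≤ : ∀ {ys} → All (_< n) ys → product (map gap ys) ≤ 2 ^ (ℓ * length ys)
  product-gap≤ [] = >-nonZero⁻¹ _ {{m^n≢0 2 (ℓ * 0)}}
  product-gap≤ {y ∷ ys} (y<n ∷ ys<n) = begin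
    gap y * product (map gap ys) ≤⟨ *-mono-≤ (≤-trans gap≤n n≤2^ℓ) (product-gap≤ ys<n) ⟩
    2 ^ ℓ * 2 ^ (ℓ * length ys)  ≡⟨ ^-distribˡ-+-* 2 ℓ (ℓ * length ys) ⟨
    2 ^ (ℓ + ℓ * length ys)      ≡⟨ cong (2 ^_) (*-suc ℓ (length ys)) ⟨
    2 ^ (ℓ * suc (length ys))    ∎
    where
    open ≤-Reasoning
    gap≤n : gap y ≤ n
    gap≤n = ⊔-lub (≤-trans (s≤s z≤n) x<n) (≤-trans (∣m-n∣≤m⊔n x y) (⊔-lub (<⇒≤ x<n) (<⇒≤ y<n)))

  Merges : ℕ → ℕ → Set
  Merges m y = x ≢ y × m ∣ ∣ x - y ∣

  merges? : ∀ m y → Dec (Merges m y)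
  merges? m y = ¬? (x ≟ y) ×-dec (m ∣? ∣ x - y ∣)

  ∣product-gap : ∀ {m ys} → Any (Merges m) ys → m ∣ product (map gap ys)
  ∣product-gap {m} {y ∷ ys} (here (x≢y , m∣gap)) =
    ∣m⇒∣m*n _ (subst (m ∣_) (sym (m≤n⇒m⊔n≡n (n≢0⇒n>0 (λ eq → x≢y (∣m-n∣≡0⇒m≡n eq))))) m∣gap)
  ∣product-gap {m} {y ∷ ys} (there any) = ∣n⇒∣m*n (gap y) (∣product-gap any)

  -- If every modulus up to 2m + 1 merged x with an element of ys, the product of
  -- the gaps to x would be a common multiple of 1, …, 2m + 1, hence at least 2^m.
  isolating-modulus : ∀ m {ys} → All (_< n) ys → ℓ * length ys < m →
                      ∃ λ a → a < suc (2 * m) × (∀ {y} → y ∈ ys → suc a ∣ ∣ x - y ∣ → x ≡ y)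
  isolating-modulus m {ys} ys<n short
    with any? (λ (a : Fin (suc (2 * m))) → ¬? (Any.any? (merges? (suc (toℕ a))) ys))
  ... | yes (a , ¬merges) = toℕ a , toℕ<n a , isolates
    where
    isolates : ∀ {y} → y ∈ ys → suc (toℕ a) ∣ ∣ x - y ∣ → x ≡ y
    isolates {y} y∈ys a∣gap with x ≟ y
    ... | yes x≡y = x≡y
    ... | no  x≢y = contradiction (Any.map (λ { refl → x≢y , a∣gap }) y∈ys) ¬merges
  ... | no ¬∃ = contradiction
      (≤-trans (2^m≤common-multiple m {{product-gap≢0 ys}} multiple) (product-gap≤ ys<n))
      (<⇒≱ (^-monoʳ-< 2 (s≤s (s≤s z≤n)) short))
    where
    multiple : ∀ a → a < suc (2 * m) → suc a ∣ product (map gap ys)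
    multiple a a< with Any.any? (merges? (suc a)) ys
    ... | yes any = ∣product-gap any
    ... | no ¬any = contradiction
        (fromℕ< a< , subst (λ b → ¬ Any (Merges (suc b)) ys) (sym (toℕ-fromℕ< a<)) ¬any) ¬∃

-- Residues and binary logarithms

≡%⇒∣ : ∀ d .{{_ : NonZero d}} x y → x % d ≡ y % d → d ∣ ∣ x - y ∣
≡%⇒∣ d x y eq = divides ∣ x / d - y / d ∣ (begin
  ∣ x - y ∣                                       ≡⟨ cong₂ ∣_-_∣ (m≡m%n+[m/n]*n x d) (m≡m%n+[m/n]*n y d) ⟩
  ∣ x % d + x / d * d - (y % d + y / d * d) ∣     ≡⟨ cong (λ r → ∣ x % d + x / d * d - (r + y / d * d) ∣) eq ⟨
  ∣ x % d + x / d * d - (x % d + y / d * d) ∣     ≡⟨ ∣m+n-m+o∣≡∣n-o∣ (x % d) _ _ ⟩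
  ∣ x / d * d - y / d * d ∣                       ≡⟨ *-distribʳ-∣-∣ d (x / d) (y / d) ⟨
  ∣ x / d - y / d ∣ * d                           ∎)
  where open ≡-Reasoning

+*-% : ∀ {d r} q .{{_ : NonZero d}} → r < d → (r + q * d) % d ≡ r
+*-% {d} {r} q r<d = trans ([m+kn]%n≡m%n r q d) (m<n⇒m%n≡m r<d)

+*-/ : ∀ {d r} q .{{_ : NonZero d}} → r < d → (r + q * d) / d ≡ q
+*-/ {d} {r} q r<d = begin
  (r + q * d) / d       ≡⟨ +-distrib-/-∣ʳ r (divides-refl q) ⟩
  r / d + q * d / d     ≡⟨ cong₂ _+_ (m<n⇒m/n≡0 r<d) (m*n/n≡m q d) ⟩
  q                     ∎
  where open ≡-Reasoning

residue-in-window : ∀ {d r} .{{_ : NonZero d}} → r < d → ∀ c → ∃ λ q → c ≤ r + q * d × r + q * d < c + d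
residue-in-window {d} {r} r<d c with c % d ≤? r
... | yes c%d≤r = c / d
    , subst (_≤ r + c / d * d) (sym (m≡m%n+[m/n]*n c d)) (+-monoˡ-≤ _ c%d≤r)
    , subst (_< c + d) (+-comm (c / d * d) r) (+-mono-≤-< (m/n*n≤m c d) r<d)
... | no c%d≰r = suc (c / d)
    , (begin
        c                     ≡⟨ m≡m%n+[m/n]*n c d ⟩
        c % d + c / d * d     ≤⟨ +-monoˡ-≤ _ (m%n≤n c d) ⟩
        d + c / d * d         ≤⟨ m≤n+m _ r ⟩
        r + (d + c / d * d)   ∎)
    , (begin-strict
        r + (d + c / d * d)       ≡⟨ cong (r +_) (+-comm d _) ⟩
        r + (c / d * d + d)       ≡⟨ +-assoc r _ d ⟨
        r + c / d * d + d         <⟨ +-monoˡ-< d (+-monoˡ-< (c / d * d) (≰⇒> c%d≰r)) ⟩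
        c % d + c / d * d + d     ≡⟨ cong (_+ d) (m≡m%n+[m/n]*n c d) ⟨
        c + d                     ∎)
  where open ≤-Reasoning

1≤⌈log₂⌉ : ∀ {n} → 2 ≤ n → 1 ≤ ⌈log₂ n ⌉
1≤⌈log₂⌉ 2≤n = ⌈log₂⌉-mono-≤ 2≤n

n≤2^⌈log₂n⌉ : ∀ n → n ≤ 2 ^ ⌈log₂ n ⌉
n≤2^⌈log₂n⌉ = <-rec _ step
  where
  open ≤-Reasoning
  step : ∀ n → (∀ {m} → m < n → m ≤ 2 ^ ⌈log₂ m ⌉) → n ≤ 2 ^ ⌈log₂ n ⌉
  step 0 _ = z≤n
  step 1 _ = ≤-refl
  step n@(suc (suc n′)) rec = begin
    n                           ≡⟨ ⌊n/2⌋+⌈n/2⌉≡n n ⟨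
    ⌊ n /2⌋ + ⌈ n /2⌉           ≤⟨ +-monoˡ-≤ _ (⌊n/2⌋≤⌈n/2⌉ n) ⟩
    ⌈ n /2⌉ + ⌈ n /2⌉           ≡⟨ cong (⌈ n /2⌉ +_) (+-identityʳ _) ⟨
    2 * ⌈ n /2⌉                 ≤⟨ *-monoʳ-≤ 2 (rec (⌈n/2⌉<n n′)) ⟩
    2 ^ suc ⌈log₂ ⌈ n /2⌉ ⌉     ≡⟨ cong (λ l → 2 ^ suc l) (⌈log₂⌈n/2⌉⌉≡⌈log₂n⌉∸1 n) ⟩
    2 ^ suc (⌈log₂ n ⌉ ∸ 1)     ≡⟨ cong (2 ^_) (m+[n∸m]≡n (1≤⌈log₂⌉ {n} (s≤s (s≤s z≤n)))) ⟩
    2 ^ ⌈log₂ n ⌉               ∎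

2^⌈log₂n⌉≤2n : ∀ n .{{_ : NonZero n}} → 2 ^ ⌈log₂ n ⌉ ≤ 2 * n
2^⌈log₂n⌉≤2n n with ⌈log₂ n ⌉ in eq
... | zero  = *-mono-≤ {1} {2} (s≤s z≤n) (>-nonZero⁻¹ n)
... | suc l = *-monoʳ-≤ 2 {2 ^ l} {n} (≮⇒≥ λ n<2^l → 1+n≰n (begin
    suc l           ≡⟨ eq ⟨
    ⌈log₂ n ⌉       ≤⟨ ⌈log₂⌉-mono-≤ (<⇒≤ n<2^l) ⟩
    ⌈log₂ 2 ^ l ⌉   ≡⟨ ⌈log₂2^n⌉≡n l ⟩
    l               ∎))
  where open ≤-Reasoning

-- Lists, sums and graphs

filter-singleton : ∀ {A : Set} {P : A → Set} (P? : Decidable P) {u xs} → Unique xs → u ∈ xs → P u →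
                   (∀ {w} → P w → w ≡ u) → filter P? xs ≡ u ∷ []
filter-singleton P? {u} (u∉ ∷ _) (here refl) pu only =
  trans (filter-accept P? pu) (cong (u ∷_) (filter-none P? (All.map (λ u≢w pw → u≢w (sym (only pw))) u∉)))
filter-singleton P? (x∉ ∷ uniq) (there u∈) pu only =
  trans (filter-reject P? (λ px → All.lookup x∉ u∈ (only px))) (filter-singleton P? uniq u∈ pu only)

length-filter-disjoint : ∀ {X : Set} {A B C : X → Set} (A? : Decidable A) (B? : Decidable B) (C? : Decidable C) →
  (∀ {x} → A x → C x) → (∀ {x} → B x → C x) → (∀ {x} → A x → ¬ B x) →
  ∀ xs → length (filter A? xs) + length (filter B? xs) ≤ length (filter C? xs)
length-filter-disjoint A? B? C? A⇒C B⇒C A⇒¬B [] = z≤n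
length-filter-disjoint A? B? C? A⇒C B⇒C A⇒¬B (x ∷ xs)
  with length-filter-disjoint A? B? C? A⇒C B⇒C A⇒¬B xs | A? x | B? x | C? x
... | ih | yes a | yes b | _     = contradiction b (A⇒¬B a)
... | ih | yes a | no _  | yes _ = s≤s ih
... | ih | no _  | yes b | yes _ = ≤-trans (≤-reflexive (+-suc _ _)) (s≤s ih)
... | ih | no _  | no _  | yes _ = m≤n⇒m≤1+n ih
... | ih | no _  | no _  | no _  = ih
... | ih | yes a | no _  | no ¬c = contradiction (A⇒C a) ¬c
... | ih | no _  | yes b | no ¬c = contradiction (B⇒C b) ¬c

∑ : ℕ → (ℕ → ℕ) → ℕ
∑ zero    f = 0
∑ (suc m) f = ∑ m f + f m

∑-mono : ∀ {f g} m → (∀ i → f i ≤ g i) → ∑ m f ≤ ∑ m g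
∑-mono zero    f≤g = z≤n
∑-mono (suc m) f≤g = +-mono-≤ (∑-mono m f≤g) (f≤g m)

∑-jump : ∀ {f g e} m {j} → j < m → (∀ i → f i ≤ g i) → f j + e ≤ g j → ∑ m f + e ≤ ∑ m g
∑-jump {f} {g} {e} (suc m) {j} j<1+m f≤g jump with m≤n⇒m<n∨m≡n (s≤s⁻¹ j<1+m)
... | inj₂ refl = ≤-trans (≤-reflexive (+-assoc (∑ m f) (f m) e)) (+-mono-≤ (∑-mono m f≤g) jump)
... | inj₁ j<m  = begin
  ∑ m f + f m + e   ≡⟨ +-assoc (∑ m f) (f m) e ⟩
  ∑ m f + (f m + e) ≡⟨ cong (∑ m f +_) (+-comm (f m) e) ⟩
  ∑ m f + (e + f m) ≡⟨ +-assoc (∑ m f) e (f m) ⟨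
  ∑ m f + e + f m   ≤⟨ +-mono-≤ (∑-jump m j<m f≤g jump) (f≤g m) ⟩
  ∑ m g + g m       ∎
  where open ≤-Reasoning

bracket : ∀ (τ : ℕ → ℕ) {d} m → τ 0 < d → d ≤ τ m → ∃ λ j → j < m × τ j < d × d ≤ τ (suc j)
bracket τ zero lo hi = contradiction hi (<⇒≱ lo)
bracket τ {d} (suc m) lo hi with d ≤? τ m
... | no d≰  = m , ≤-refl , ≰⇒> d≰ , hi
... | yes d≤ with j , j<m , p ← bracket τ m lo d≤ = j , m<n⇒m<1+n j<m , p

Star-unsnoc : ∀ {A : Set} {R : A → A → Set} {x z} → Star R x z → x ≡ z ⊎ (∃ λ y → Star R x y × R y z)
Star-unsnoc ε = inj₁ refl
Star-unsnoc (r ◅ rs) with Star-unsnoc rs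
... | inj₁ refl          = inj₂ (_ , ε , r)
... | inj₂ (y , rs′ , r′) = inj₂ (y , r ◅ rs′ , r′)

-- The transitive closure of the edges is a strict partial order, irreflexive by acyclicity, and
-- such orders on a finite set are well-founded.
Edge-wellFounded : ∀ {n} {G : Graph n} → Acyclic G → WellFounded (Edge G)
Edge-wellFounded {G = G} acyclic = wellFounded⁻ _ (spo-wellFounded isSPO)
  where
  toStar : ∀ {u v} → TransClosure (Edge G) u v → ∃ λ w → Edge G u w × Reach G w v
  toStar [ e ]    = _ , e , ε
  toStar (e ∷ es) with w , e′ , r ← toStar es = _ , e , e′ ◅ r
  isSPO : IsStrictPartialOrder _≡_ (TransClosure (Edge G))
  isSPO = record
    { isEquivalence = isEquivalence
    ; irrefl = λ { refl p → let w , e , r = toStar p in acyclic _ w e r }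
    ; trans = _++_
    ; <-resp-≈ = (λ { refl p → p }) , (λ { refl p → p })
    }

Contains-∈ : ∀ {x y h h′} → just (msg y h) ∈ h′ → x ≡ y ⊎ Contains x h → Contains x h′
Contains-∈ (here refl) (inj₁ refl) = here
Contains-∈ (here refl) (inj₂ c)    = deep c
Contains-∈ (there m∈)  x           = later (Contains-∈ m∈ x)

-- Executions of a protocol on a graph

module Run (P : Protocol) {n : ℕ} (G : Graph n) where

  H : ℕ → Fin n → History
  H = hist P G

  Transmits : ℕ → Fin n → Set
  Transmits s u = T (P n u (H s u))

  message : ℕ → Fin n → Msg
  message s u = msg (toℕ u) (H s u)

  length-H : ∀ s v → length (H s v) ≡ s
  length-H zero    v = refl
  length-H (suc s) v = cong suc (length-H s v)

  drop-H : ∀ d s v → drop d (H s v) ≡ H (s ∸ d) v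
  drop-H zero    s       v = refl
  drop-H (suc d) zero    v = refl
  drop-H (suc d) (suc s) v = drop-H d s v

  Any-H-mono : ∀ {Q : Maybe Msg → Set} {s s′ v} → s ≤ s′ → Any Q (H s v) → Any Q (H s′ v)
  Any-H-mono {Q} {s} {v = v} s≤s′ any = go (≤⇒≤′ s≤s′)
    where
    go : ∀ {s′} → s ≤′ s′ → Any Q (H s′ v)
    go ≤′-refl       = any
    go (≤′-step s≤′) = there (go s≤′)

  ∈H⇒sent : ∀ {m} s {v} → just m ∈ H s v →
            ∃ λ s′ → ∃ λ u → s′ < s × Edge G u v × Transmits s′ u × m ≡ message s′ u
  ∈H⇒sent (suc s) (there m∈) with s′ , u , s′<s , p ← ∈H⇒sent s m∈ = s′ , u , m<n⇒m<1+n s′<s , p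
  ∈H⇒sent (suc s) {v} (here eq)
    with P n v (H s v) | filterᵇ (λ u → G u v ∧ P n u (H s u)) (allFin n) in senders
  -- All other cases record `nothing`: the receiver transmits, or the number of senders is not one.
  ... | false | u ∷ [] with refl ← eq = s , u , ≤-refl , proj₁ both , proj₂ both , refl
    where
    both : Edge G u v × Transmits s u
    both = Equivalence.to T-∧ (proj₂ (∈-filter⁻ (λ w → T? (G w v ∧ P n w (H s w))) {xs = allFin n}
             (subst (u ∈_) (sym senders) (here refl))))

  sole-sender : ∀ {s u v} → Edge G u v → Transmits s u → (∀ {w} → Edge G w v → Transmits s w → w ≡ u) →
                filterᵇ (λ w → G w v ∧ P n w (H s w)) (allFin n) ≡ u ∷ []
  sole-sender {s} {u} {v} e sends only =
    filter-singleton (λ w → T? (G w v ∧ P n w (H s w))) (allFin⁺ n) (∈-allFin u)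
      (Equivalence.from T-∧ (e , sends))
      (λ both → only (proj₁ (Equivalence.to T-∧ both)) (proj₂ (Equivalence.to T-∧ both)))

  receive : ∀ {s u v} → Edge G u v → Transmits s u → ¬ Transmits s v →
            (∀ {w} → Edge G w v → Transmits s w → w ≡ u) → just (message s u) ∈ H (suc s) v
  receive {s} {u} {v} e sends listens only with P n v (H s v) | listens
  ... | true  | listens′ = contradiction _ listens′
  ... | false | _ rewrite sole-sender {s} e sends only = here refl

-- The protocol

sender : Msg → ℕ
sender (msg x _) = x

past : Msg → History
past (msg _ h) = h

-- The length of the sender's history is the step of transmission, so the lower bound discards the
-- introductions of the first `n` steps.
Announces : ℕ → ℕ → Maybe Msg → Set
Announces n x = MAny.Any (λ m → sender m ≡ x × n ≤ length (past m))

Heard : ℕ → History → ℕ → Set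
Heard n h x = Any (Announces n x) h

heard? : ∀ n h x → Dec (Heard n h x)
heard? n h x = Any.any? (MAny.dec (λ m → sender m ≟ x ×-dec n ≤? length (past m))) h

-- Every in-neighbour is heard in the first n steps; the node is complete once
-- each of them has been heard again later.
Complete : ℕ → History → Set
Complete n h = n ≤ length h × All (MAll.All (λ m → Heard n h (sender m))) h

complete? : ∀ n h → Dec (Complete n h)
complete? n h = n ≤? length h ×-dec All.all? (MAll.dec (λ m → heard? n h (sender m))) h

-- Makes `2 ^ classes n` agree with √n up to a constant factor; from that strength on the round
-- robin takes over.
classes : ℕ → ℕ
classes n = ⌈ ⌈log₂ n ⌉ /2⌉

slots : ℕ → ℕ
slots n = suc (classes n)

-- The value of `m` with which `isolating-modulus` handles fewer than `2 ^ j` labels.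
spread : ℕ → ℕ → ℕ
spread n j = ⌈log₂ n ⌉ * 2 ^ j

moduli : ℕ → ℕ → ℕ
moduli n j = suc (2 * spread n j)

-- The period of the selector of class j is span n (suc j); span n 0 only serves as the
-- least threshold for a delay.
span : ℕ → ℕ → ℕ
span n zero    = 0
span n (suc j) = moduli n j * moduli n j * slots n

RoundRobin : ∀ n → Fin n → ℕ → Set
RoundRobin n v s = s % slots n ≡ classes n × s / slots n % suc n ≡ toℕ v

-- Divided by the number of slots, a step of class j encodes a residue (low digit in base
-- moduli n j) and the predecessor of a modulus (next digit).
Matches : ∀ n → ℕ → Fin n → ℕ → Set
Matches n j v s =
  s % slots n ≡ j × toℕ v % suc (s / slots n / moduli n j % moduli n j) ≡ s / slots n % moduli n j

-- Dropping the latest entries of a history yields the node's own history one period ago.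
Selected : ∀ n → ℕ → Fin n → History → Set
Selected n j v h = Matches n j v (length h) × ¬ Complete n (drop (span n (suc j)) h)

Sends : ∀ n → Fin n → History → Set
Sends n v h =
  length h ≡ toℕ v ⊎
  Complete n h × (RoundRobin n v (length h) ⊎ (∃ λ (j : Fin (classes n)) → Selected n (toℕ j) v h))

sends? : ∀ n v h → Dec (Sends n v h)
sends? n v h =
  length h ≟ toℕ v ⊎-dec
  (complete? n h ×-dec
    ((_ ≟ _ ×-dec _ ≟ _) ⊎-dec
     any? (λ j → (_ ≟ _ ×-dec _ ≟ _) ×-dec ¬? (complete? n (drop (span n (suc (toℕ j))) h)))))

abstract
  protocol : Protocol
  protocol n v h = ⌊ sends? n v h ⌋

  protocol⇒sends : ∀ {n v h} → T (protocol n v h) → Sends n v h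
  protocol⇒sends = toWitness

  sends⇒protocol : ∀ {n v h} → Sends n v h → T (protocol n v h)
  sends⇒protocol = fromWitness

-- Slot, residue and modulus are independent digits of a step, so choosing all three fixes its
-- residue modulo the period.
matching-step : ∀ {n} j → j < slots n → ∀ v c {a} → a < moduli n j →
  ∃ λ s → c ≤ s × s < c + span n (suc j) × Matches n j v s × s / slots n / moduli n j % moduli n j ≡ a
matching-step {n} j j<L v c {a} a<Q = s , c≤s , s<c+ , (s%L , trans v%≡b (sym s/L%Q)) , s/L/Q%Q
  where
  L = slots n
  Q = moduli n j
  b = toℕ v % suc a
  b<Q : b < Q
  b<Q = ≤-trans (m%n<n (toℕ v) (suc a)) a<Q
  r<period : j + (b + a * Q) * L < Q * Q * L
  r<period = begin-strict
    j + (b + a * Q) * L     <⟨ +-monoˡ-< _ j<L ⟩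
    L + (b + a * Q) * L     ≤⟨ *-monoˡ-≤ L {suc b + a * Q} {Q * Q} (begin
      suc b + a * Q           ≤⟨ +-monoˡ-≤ (a * Q) b<Q ⟩
      suc a * Q               ≤⟨ *-monoˡ-≤ Q a<Q ⟩
      Q * Q                   ∎) ⟩
    Q * Q * L               ∎
    where open ≤-Reasoning
  window = residue-in-window r<period c
  q = proj₁ window
  s = j + (b + (a + q * Q) * Q) * L
  s-eq : j + (b + a * Q) * L + q * (Q * Q * L) ≡ s
  s-eq = e j b a q Q L
    where
    e : ∀ j b a q Q L → j + (b + a * Q) * L + q * (Q * Q * L) ≡ j + (b + (a + q * Q) * Q) * L
    e = solve-∀
  c≤s : c ≤ s
  c≤s = subst (c ≤_) s-eq (proj₁ (proj₂ window))
  s<c+ : s < c + span n (suc j)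
  s<c+ = subst (_< c + span n (suc j)) s-eq (proj₂ (proj₂ window))
  s%L : s % L ≡ j
  s%L = +*-% (b + (a + q * Q) * Q) j<L
  s/L : s / L ≡ b + (a + q * Q) * Q
  s/L = +*-/ (b + (a + q * Q) * Q) j<L
  s/L%Q : s / L % Q ≡ b
  s/L%Q = trans (cong (_% Q) s/L) (+*-% (a + q * Q) b<Q)
  s/L/Q%Q : s / L / Q % Q ≡ a
  s/L/Q%Q = trans (cong (λ x → x / Q % Q) s/L) (trans (cong (_% Q) (+*-/ (a + q * Q) b<Q)) (+*-% q a<Q))
  v%≡b : toℕ v % suc (s / L / Q % Q) ≡ b
  v%≡b = cong (λ x → toℕ v % suc x) s/L/Q%Q

round-robin-step : ∀ {n} v c → ∃ λ s → c ≤ s × s < c + suc n * slots n × RoundRobin n v s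
round-robin-step {n} v c =
  s , subst (c ≤_) s-eq (proj₁ (proj₂ window)) , subst (_< c + suc n * L) s-eq (proj₂ (proj₂ window))
  , +*-% (toℕ v + q * suc n) (n<1+n (classes n))
  , trans (cong (_% suc n) (+*-/ (toℕ v + q * suc n) (n<1+n (classes n)))) (+*-% q v<1+n)
  where
  L = slots n
  v<1+n : toℕ v < suc n
  v<1+n = m<n⇒m<1+n (toℕ<n v)
  window = residue-in-window (≤-trans (+-monoˡ-< (toℕ v * L) (n<1+n (classes n))) (*-monoˡ-≤ L v<1+n)) c
  q = proj₁ window
  s = classes n + (toℕ v + q * suc n) * L
  s-eq : classes n + toℕ v * L + q * (suc n * L) ≡ s
  s-eq = e (classes n) (toℕ v) q n L
    where
    e : ∀ j v q n L → j + v * L + q * (suc n * L) ≡ j + (v + q * suc n) * L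
    e = solve-∀

-- The number of nodes that must become complete around a node for it to be delayed by more
-- than 2 * span n j: one (the node itself) for j = 0, and 2^i for the class i with j = suc i.
quota : ℕ → ℕ
quota j = 2 ^ pred j

quota≢0 : ∀ j → NonZero (quota j)
quota≢0 j = m^n≢0 2 (pred j)

share : ℕ → ℕ → ℕ
share m j = (m / quota j) {{quota≢0 j}}

share-mono : ∀ {m m′} j → m ≤ m′ → share m j ≤ share m′ j
share-mono j = /-monoˡ-≤ (quota j) {{quota≢0 j}}

share-+quota : ∀ m j → share (m + quota j) j ≡ share m j + 1
share-+quota m j = trans (+-distrib-/-∣ʳ m {{quota≢0 j}} ∣-refl) (cong (share m j +_) (n/n≡1 (quota j) {{quota≢0 j}}))

cost : ℕ → ℕ → ℕ → ℕ
cost n m j = 2 * span n (suc j) * share m j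

-- Running time

module Analysis {n : ℕ} (2≤n : 2 ≤ n) (G : Graph n) (acyclic : Acyclic G) where

  open Run protocol G

  Done : ℕ → Fin n → Set
  Done s v = Complete n (H s v)

  done? : ∀ s v → Dec (Done s v)
  done? s v = complete? n (H s v)

  Hears : ℕ → Fin n → Fin n → Set
  Hears s v u = Heard n (H s v) (toℕ u)

  transmits⇒sends : ∀ {s v} → Transmits s v → Sends n v (H s v)
  transmits⇒sends = protocol⇒sends

  sends⇒transmits : ∀ {s v} → Sends n v (H s v) → Transmits s v
  sends⇒transmits = sends⇒protocol

  early-transmission : ∀ {s v} → s < n → Transmits s v → s ≡ toℕ v
  early-transmission {s} {v} s<n tr with transmits⇒sends tr
  ... | inj₁ eq             = trans (sym (length-H s v)) eq
  ... | inj₂ ((n≤len , _) , _) = contradiction (subst (n ≤_) (length-H s v) n≤len) (<⇒≱ s<n)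

  -- Before step `n` a node transmits only at the step equal to its label, so `u` is alone at its
  -- own step.
  introduction : ∀ {s u v} → n ≤ s → Edge G u v → just (message (toℕ u) u) ∈ H s v
  introduction {s} {u} {v} n≤s e =
    Any-H-mono (≤-trans (toℕ<n u) n≤s)
      (receive e (sends⇒transmits {toℕ u} (inj₁ (length-H (toℕ u) u))) v-listens
        (λ _ tr → toℕ-injective (sym (early-transmission (toℕ<n u) tr))))
    where
    -- A transmission by `v` in this step would make `v` equal to `u` and the edge a self-loop.
    v-listens : ¬ Transmits (toℕ u) v
    v-listens tr with refl ← toℕ-injective (early-transmission (toℕ<n u) tr) = acyclic u u e ε

  Done⇒n≤ : ∀ {s v} → Done s v → n ≤ s
  Done⇒n≤ {s} {v} (n≤len , _) = subst (n ≤_) (length-H s v) n≤len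

  -- The introduction of `u` stands in the history of `v`, so completeness requires that `u` was
  -- heard again.
  Done⇒hears : ∀ {s u v} → Done s v → Edge G u v → Hears s v u
  Done⇒hears {s} {u} {v} k e with All.lookup (proj₂ k) (introduction (Done⇒n≤ k) e)
  ... | MAll.just heard = heard

  hears⇒Done : ∀ {s v} → n ≤ s → (∀ u → Edge G u v → Hears s v u) → Done s v
  hears⇒Done {s} {v} n≤s all = subst (n ≤_) (sym (length-H s v)) n≤s , All.tabulate entry
    where
    entry : ∀ {m} → m ∈ H s v → MAll.All (λ m → Heard n (H s v) (sender m)) m
    entry {nothing} _ = MAll.nothing
    entry {just m} m∈ with s′ , u , _ , e , _ , refl ← ∈H⇒sent s m∈ = MAll.just (all u e)

  -- Later messages bring in no new senders: all senders are in-neighbours and have been heard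
  -- already.
  Done-mono : ∀ {s s′ v} → s ≤ s′ → Done s v → Done s′ v
  Done-mono s≤s′ k = hears⇒Done (≤-trans (Done⇒n≤ k) s≤s′) (λ u e → Any-H-mono s≤s′ (Done⇒hears k e))

  late-transmission : ∀ {s v} → n ≤ s → Transmits s v →
    Done s v × (RoundRobin n v s ⊎ ∃ λ (j : Fin (classes n)) → Matches n (toℕ j) v s × ¬ Done (s ∸ span n (suc (toℕ j))) v)
  late-transmission {s} {v} n≤s tr with transmits⇒sends tr
  ... | inj₁ eq = contradiction (subst (_< n) (sym (trans (sym (length-H s v)) eq)) (toℕ<n v)) (≤⇒≯ n≤s)
  ... | inj₂ (k , inj₁ rr) = k , inj₁ (subst (RoundRobin n v) (length-H s v) rr)
  ... | inj₂ (k , inj₂ (j , match , ¬old)) =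
    k , inj₂ (j , subst (Matches n (toℕ j) v) (length-H s v) match
                , subst (λ h → ¬ Complete n h) (drop-H (span n (suc (toℕ j))) s v) ¬old)

  transmits-RoundRobin : ∀ {s v} → Done s v → RoundRobin n v s → Transmits s v
  transmits-RoundRobin {s} {v} k rr =
    sends⇒transmits {s} (inj₂ (k , inj₁ (subst (RoundRobin n v) (sym (length-H s v)) rr)))

  transmits-Selected : ∀ {s v} (j : Fin (classes n)) → Done s v → Matches n (toℕ j) v s →
                       ¬ Done (s ∸ span n (suc (toℕ j))) v → Transmits s v
  transmits-Selected {s} {v} j k match ¬old =
    sends⇒transmits {s} (inj₂ (k , inj₂ (j , subst (Matches n (toℕ j) v) (sym (length-H s v)) match
      , subst (λ h → ¬ Complete n h) (sym (drop-H (span n (suc (toℕ j))) s v)) ¬old)))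

  -- A receiver that might itself be transmitting is complete and has therefore heard `u` before.
  deliver : ∀ {s u v} → n ≤ s → Edge G u v → Transmits s u → (∀ {w} → Transmits s w → w ≡ u) → Hears (suc s) v u
  deliver {s} {u} {v} n≤s e tr only with done? s v
  ... | yes k = there (Done⇒hears k e)
  ... | no ¬k = lose (receive e tr (λ tr′ → ¬k (proj₁ (late-transmission n≤s tr′))) (λ _ → only))
                     (MAny.just (refl , subst (n ≤_) (sym (length-H s u)) n≤s))

  -- Only complete nodes transmit after the introductions, so a message that counts as heard proves
  -- its sender complete.
  hears⇒sent : ∀ {s u v} → Hears s v u → ∃ λ s′ → s′ < s × Done s′ u × just (message s′ u) ∈ H s v
  hears⇒sent {s} {u} {v} heard with find heard
  ... | just m , m∈ , MAny.just (from-u , n≤past) with ∈H⇒sent s m∈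
  ...   | s′ , w , s′<s , e , tr , refl with refl ← toℕ-injective from-u =
    s′ , s′<s , proj₁ (late-transmission (subst (n ≤_) (length-H s′ u) n≤past) tr) , m∈

  -- Induction along edges: the last node before `v` on the path was complete when it sent what `v`
  -- heard, so that message carries the rumour of `u`.
  Done⇒holds : ∀ {s v} → Acc (Edge G) v → Done s v → ∀ u → Reach G u v → Holds protocol G s v u
  Done⇒holds (acc rec) k u path with Star-unsnoc path
  ... | inj₁ u≡v = inj₁ u≡v
  ... | inj₂ (w , path′ , e) with s′ , _ , k′ , m∈ ← hears⇒sent (Done⇒hears k e) =
    inj₂ (Contains-∈ m∈ ([ (λ { refl → inj₁ refl }) , inj₂ ]′ (Done⇒holds (rec e) k′ u path′)))

  First : ℕ → Fin n → Set
  First c v = Done c v × (∀ {s} → s < c → ¬ Done s v)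

  first : ∀ s {v} → Done s v → ∃ λ c → First c v × c ≤ s
  first zero    k = 0 , (k , λ ()) , ≤-refl
  first (suc s) {v} k with done? s v
  ... | yes k′ with c , fst , c≤s ← first s k′ = c , fst , m≤n⇒m≤1+n c≤s
  ... | no ¬k′ = suc s , (k , λ s′<1+s k′ → ¬k′ (Done-mono (s≤s⁻¹ s′<1+s) k′)) , ≤-refl

  round-robin-step-alone : ∀ {s u} → Done s u → RoundRobin n u s → ∀ {w} → Transmits s w → w ≡ u
  round-robin-step-alone k rr tr with proj₂ (late-transmission (Done⇒n≤ k) tr)
  ... | inj₁ (_ , w≡) = toℕ-injective (trans (sym w≡) (proj₂ rr))
  ... | inj₂ (j , (s%≡j , _) , _) = contradiction (trans (sym s%≡j) (proj₁ rr)) (<⇒≢ (toℕ<n j))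

  round-robin-delivers : ∀ {c u v} → Done c u → Edge G u v → Hears (c + suc n * slots n) v u
  round-robin-delivers {c} {u} k e =
    let s , c≤s , s<c+d , rr = round-robin-step u c
        k′ = Done-mono c≤s k
    in Any-H-mono s<c+d (deliver (Done⇒n≤ k′) e (transmits-RoundRobin k′ rr) (round-robin-step-alone k′ rr))

  -- Covers every node that may use a selector of period `d` at a step from `c` up to `c + d`.
  -- Subtracting `suc d` lets a node first complete at `c` count even when `d` is 0.
  Rival : ℕ → ℕ → Fin n → Set
  Rival c d w = Done (c + d) w × ¬ Done (c ∸ suc d) w

  rival? : ∀ c d w → Dec (Rival c d w)
  rival? c d w = done? (c + d) w ×-dec ¬? (done? (c ∸ suc d) w)

  rivals : ℕ → ℕ → List (Fin n)
  rivals c d = filter (rival? c d) (allFin n)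

  1≤ℓ : 1 ≤ ⌈log₂ n ⌉
  1≤ℓ = 1≤⌈log₂⌉ 2≤n

  module _ (j : Fin (classes n)) {c : ℕ} {u : Fin n} (u-first : First c u) where

    d : ℕ
    d = span n (suc (toℕ j))

    Isolates : ℕ → Set
    Isolates a = ∀ {y} → y ∈ map toℕ (rivals c d) → suc a ∣ ∣ toℕ u - y ∣ → toℕ u ≡ y

    -- For one period after `c` the node `u` uses this selector; any transmitter in the same slot is
    -- a rival with the same residue, hence `u` by `Isolates`.
    isolating-step : ∀ {s a} → c ≤ s → s < c + d → Matches n (toℕ j) u s → Isolates a →
                     s / slots n / moduli n (toℕ j) % moduli n (toℕ j) ≡ a →
                     Transmits s u × (∀ {w} → Transmits s w → w ≡ u)
    isolating-step {s} c≤s s<c+d match isolates refl =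
      transmits-Selected j (Done-mono c≤s (proj₁ u-first)) match (proj₂ u-first s∸d<c) , only
      where
      n≤s : n ≤ s
      n≤s = ≤-trans (Done⇒n≤ (proj₁ u-first)) c≤s
      s∸d<c : s ∸ d < c
      s∸d<c = m<n+o⇒m∸n<o s d {{>-nonZero (≤-trans (s≤s z≤n) (≤-trans 2≤n (Done⇒n≤ (proj₁ u-first))))}}
                (subst (s <_) (+-comm c d) s<c+d)
      rival : ∀ {w} → Done s w → ¬ Done (s ∸ d) w → Rival c d w
      rival k ¬old = Done-mono (<⇒≤ s<c+d) k , λ old → ¬old (Done-mono (∸-mono c≤s (n≤1+n d)) old)
      same-class : ∀ {w} → Done s w → ¬ Done (s ∸ d) w → Matches n (toℕ j) w s → w ≡ u
      same-class {w} k ¬old match′ =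
        toℕ-injective (sym (isolates (∈-map⁺ toℕ (∈-filter⁺ (rival? c d) (∈-allFin w) (rival k ¬old)))
          (≡%⇒∣ _ (toℕ u) (toℕ w) (trans (proj₂ match) (sym (proj₂ match′))))))
      only : ∀ {w} → Transmits s w → w ≡ u
      only {w} tr with late-transmission n≤s tr
      ... | _ , inj₁ (s%≡ , _) = contradiction (trans (sym (proj₁ match)) s%≡) (<⇒≢ (toℕ<n j))
      ... | k , inj₂ (j′ , match′ , ¬old)
        with refl ← toℕ-injective {i = j′} {j = j} (trans (sym (proj₁ match′)) (proj₁ match)) = same-class k ¬old match′

    -- So few rivals leave an isolating modulus, and within one period comes a step of this class
    -- with that modulus and the residue of `u`.
    selector-delivers : ∀ {v} → Edge G u v → length (rivals c d) < 2 ^ toℕ j → Hears (c + d) v u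
    selector-delivers e few =
      let a , a<Q , isolates = isolating-modulus {n} {⌈log₂ n ⌉} (n≤2^⌈log₂n⌉ n) (toℕ<n u) (spread n (toℕ j))
            {map toℕ (rivals c d)} (map⁺ (All.tabulate (λ {w} _ → toℕ<n w)))
            (*-monoʳ-< ⌈log₂ n ⌉ {{>-nonZero 1≤ℓ}} (subst (_< 2 ^ toℕ j) (sym (length-map toℕ (rivals c d))) few))
          s , c≤s , s<c+d , match , s≡a = matching-step (toℕ j) (m<n⇒m<1+n (toℕ<n j)) u c a<Q
          sends , only = isolating-step c≤s s<c+d match isolates s≡a
      in Any-H-mono s<c+d (deliver (≤-trans (Done⇒n≤ (proj₁ u-first)) c≤s) e sends only)

  -- Completed nodes and the potential

  completed : ℕ → ℕ
  completed s = length (filter (done? s) (allFin n))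

  completed≤n : ∀ s → completed s ≤ n
  completed≤n s = ≤-trans (length-filter (done? s) (allFin n)) (≤-reflexive (length-tabulate (λ (w : Fin n) → w)))

  completed-rivals : ∀ c d → completed (c ∸ suc d) + length (rivals c d) ≤ completed (c + d)
  completed-rivals c d = length-filter-disjoint (done? (c ∸ suc d)) (rival? c d) (done? (c + d))
    (Done-mono (≤-trans (m∸n≤m c (suc d)) (m≤m+n c d))) proj₁ (λ k r → proj₂ r k) (allFin n)

  completed-mono : ∀ {s s′} → s ≤ s′ → completed s ≤ completed s′
  completed-mono {s} {s′} s≤s′ = ≤-trans (m≤m+n (completed s) _)
    (length-filter-disjoint (done? s) (λ _ → no (λ (b : ⊥) → b)) (done? s′) (Done-mono s≤s′) (λ ()) (λ _ ()) (allFin n))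

  many-rivals-class : ∀ (i : Fin (classes n)) {j c u v} → toℕ i ≡ j → First c u → Edge G u v →
                      ¬ Hears (c + span n (suc j)) v u → 2 ^ j ≤ length (rivals c (span n (suc j)))
  many-rivals-class i refl fst e ¬hears = ≮⇒≥ (λ few → ¬hears (selector-delivers i fst e few))

  -- For the selectors this is the contrapositive of `selector-delivers`; at level 0 the node `u` is
  -- its own rival, as `c` is its first complete step.
  many-rivals : ∀ j → j ≤ classes n → ∀ {c u v} → First c u → Edge G u v → ¬ Hears (c + span n j) v u →
                quota j ≤ length (rivals c (span n j))
  many-rivals zero _ {c} {u} (k , ¬earlier) _ _ = nonempty (∈-filter⁺ (rival? c 0) (∈-allFin u) u-rival)
    where
    nonempty : ∀ {x : Fin n} {xs} → x ∈ xs → 1 ≤ length xs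
    nonempty (here _)  = s≤s z≤n
    nonempty (there _) = s≤s z≤n
    u-rival : Rival c 0 u
    u-rival = Done-mono (m≤m+n c 0) k
            , ¬earlier (∸-monoʳ-< {c} {1} {0} (s≤s z≤n) (≤-trans (s≤s z≤n) (≤-trans 2≤n (Done⇒n≤ k))))
  many-rivals (suc j) j<J = many-rivals-class (fromℕ< j<J) (toℕ-fromℕ< j<J)

  -- A node that delays its successor by between 2 * span n j and 2 * span n (suc j) raises the
  -- j-th share by one: it counts the groups of quota j nodes completed span n j steps earlier.
  potential : ℕ → ℕ
  potential c = ∑ (suc (classes n)) (λ j → cost n (completed (c ∸ suc (span n j))) j)

  horizon : ℕ
  horizon = n + ∑ (suc (classes n)) (cost n n)

  potential≤horizon : ∀ c → n + potential c ≤ horizon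
  potential≤horizon c =
    +-monoʳ-≤ n (∑-mono (suc (classes n)) (λ j → *-monoʳ-≤ (2 * span n (suc j)) (share-mono j (completed≤n _))))

  -- The rivals around `c` become complete after the step counted at `c` and, `c′` being far enough,
  -- no later than the step counted at `c′`. So the share of `j` grows by one, and no other share
  -- drops.
  potential-jump : ∀ {c c′ j} → j ≤ classes n → quota j ≤ length (rivals c (span n j)) → c + 2 * span n j < c′ →
                   potential c + 2 * span n (suc j) ≤ potential c′
  potential-jump {c} {c′} {j} j≤J many far = ∑-jump (suc (classes n)) (s≤s j≤J)
    (λ i → *-monoʳ-≤ (2 * span n (suc i)) (share-mono i (completed-mono (∸-monoˡ-≤ (suc (span n i)) c≤c′)))) (begin
      D * share x j + D               ≡⟨ e D (share x j) ⟩
      D * (share x j + 1)             ≡⟨ cong (D *_) (share-+quota x j) ⟨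
      D * share (x + quota j) j       ≤⟨ *-monoʳ-≤ D (share-mono j (begin
        x + quota j                        ≤⟨ +-monoʳ-≤ x many ⟩
        x + length (rivals c (span n j))   ≤⟨ completed-rivals c (span n j) ⟩
        completed (c + span n j)
          ≤⟨ completed-mono (m+n≤o⇒m≤o∸n (c + span n j) (≤-trans (≤-reflexive (e′ c (span n j))) far)) ⟩
        completed (c′ ∸ suc (span n j))    ∎)) ⟩
      D * share (completed (c′ ∸ suc (span n j))) j ∎)
    where
    open ≤-Reasoning
    D = 2 * span n (suc j)
    x = completed (c ∸ suc (span n j))
    c≤c′ : c ≤ c′
    c≤c′ = ≤-trans (m≤m+n c _) (<⇒≤ far)
    e : ∀ D y → D * y + D ≡ D * (y + 1)
    e = solve-∀
    e′ : ∀ c d → c + d + suc d ≡ suc (c + 2 * d)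
    e′ = solve-∀

  n≤2^2J : n ≤ 2 ^ classes n * 2 ^ classes n
  n≤2^2J = begin
    n                             ≤⟨ n≤2^⌈log₂n⌉ n ⟩
    2 ^ ⌈log₂ n ⌉                 ≡⟨ cong (2 ^_) (⌊n/2⌋+⌈n/2⌉≡n ⌈log₂ n ⌉) ⟨
    2 ^ (⌊ ⌈log₂ n ⌉ /2⌋ + J)     ≤⟨ ^-monoʳ-≤ 2 (+-monoˡ-≤ J (⌊n/2⌋≤⌈n/2⌉ ⌈log₂ n ⌉)) ⟩
    2 ^ (J + J)                   ≡⟨ ^-distribˡ-+-* 2 J J ⟩
    2 ^ J * 2 ^ J                 ∎
    where
    open ≤-Reasoning
    J = classes n

  -- Since `2 ^ classes n` squared is at least `n`, the last threshold covers every delay that the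
  -- round robin permits, as `bracket` needs.
  round-robin≤span : suc n * slots n ≤ 2 * span n (suc (classes n))
  round-robin≤span = begin
    suc n * L         ≤⟨ *-monoˡ-≤ L (+-mono-≤ (≤-trans (s≤s z≤n) 2≤n) (≤-refl {n})) ⟩
    (n + n) * L       ≤⟨ *-monoˡ-≤ L (+-mono-≤ n≤QQ n≤QQ) ⟩
    (Q * Q + Q * Q) * L ≡⟨ e Q L ⟩
    2 * (Q * Q * L)   ∎
    where
    open ≤-Reasoning
    L = slots n
    Q = moduli n (classes n)
    2^J≤Q : 2 ^ classes n ≤ Q
    2^J≤Q = m≤n⇒m≤1+n (≤-trans (m≤n*m _ ⌈log₂ n ⌉ {{>-nonZero 1≤ℓ}}) (m≤n*m (spread n (classes n)) 2))
    n≤QQ : n ≤ Q * Q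
    n≤QQ = ≤-trans n≤2^2J (*-mono-≤ 2^J≤Q 2^J≤Q)
    e : ∀ Q L → (Q * Q + Q * Q) * L ≡ 2 * (Q * Q * L)
    e = solve-∀

  Timely : Fin n → Set
  Timely v = ∃ λ c → First c v × c ≤ n + potential c

  unheard : ∀ {s v} → n ≤ s → ¬ Done s v → ∃ λ u → Edge G u v × ¬ Hears s v u
  unheard {s} {v} n≤s ¬k with any? (λ u → T? (G u v) ×-dec ¬? (heard? n (H s v) (toℕ u)))
  ... | yes found = found
  ... | no ¬found = contradiction (hears⇒Done n≤s all-heard) ¬k
    where
    all-heard : ∀ u → Edge G u v → Hears s v u
    all-heard u e with heard? n (H s v) (toℕ u)
    ... | yes heard = heard
    ... | no ¬heard = contradiction (u , e , ¬heard) ¬found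

  -- The delay lies between two thresholds: exceeding the lower one forces enough rivals around `c`,
  -- and the resulting rise of the potential pays for the upper one.
  delay-bound : ∀ {s u v c} → First c u → c ≤ s → c ≤ n + potential c → Edge G u v → ¬ Hears s v u →
                suc s ≤ n + potential (suc s)
  delay-bound {s} {u} {v} {c} fst c≤s c≤ e ¬hears =
    let j , j<1+J , lo , hi = bracket (λ j → 2 * span n j) {suc s ∸ c} (suc (classes n)) (m<n⇒0<n∸m (s≤s c≤s)) short
        far : c + 2 * span n j < suc s
        far = subst (c + 2 * span n j <_) (m+[n∸m]≡n (m≤n⇒m≤1+n c≤s)) (+-monoʳ-< c lo)
        c+d≤s : c + span n j ≤ s
        c+d≤s = s≤s⁻¹ (≤-trans (s≤s (+-monoʳ-≤ c (m≤n*m (span n j) 2))) far)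
        many = many-rivals j (s≤s⁻¹ j<1+J) fst e (λ heard → ¬hears (Any-H-mono c+d≤s heard))
    in begin
      suc s                                     ≡⟨ m+[n∸m]≡n (m≤n⇒m≤1+n c≤s) ⟨
      c + (suc s ∸ c)                           ≤⟨ +-mono-≤ c≤ hi ⟩
      n + potential c + 2 * span n (suc j)      ≡⟨ +-assoc n (potential c) _ ⟩
      n + (potential c + 2 * span n (suc j))    ≤⟨ +-monoʳ-≤ n (potential-jump (s≤s⁻¹ j<1+J) many far) ⟩
      n + potential (suc s)                     ∎
    where
    open ≤-Reasoning
    short : suc s ∸ c ≤ 2 * span n (suc (classes n))
    short = ≤-trans (m≤n+o⇒m∸n≤o (suc s) c (≰⇒> (λ early → ¬hears (Any-H-mono early (round-robin-delivers (proj₁ fst) e)))))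
                    round-robin≤span

  first-bound : ∀ {c v} → (∀ {u} → Edge G u v → Timely u) → First c v → c ≤ n + potential c
  first-bound {c} {v} timely (k , ¬earlier) with m≤n⇒m<n∨m≡n (Done⇒n≤ k)
  ... | inj₂ refl = m≤m+n n _
  first-bound {suc s} {v} timely (k , ¬earlier) | inj₁ n<c =
    -- An in-neighbour still unheard one step before completion is the one that `v` waits for.
    let u , e , ¬hears = unheard (s≤s⁻¹ n<c) (¬earlier ≤-refl)
        c , fst , c≤ = timely e
        s′ , s′<1+s , k′ , _ = hears⇒sent (Done⇒hears k e)
    in delay-bound fst (≤-trans (≮⇒≥ (λ s′<c → proj₂ fst s′<c k′)) (s≤s⁻¹ s′<1+s)) c≤ e ¬hears

  -- That `v` completes at all follows from one more round robin after `horizon`; `first-bound` then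
  -- sharpens this crude time.
  completes-timely : ∀ {v} → Acc (Edge G) v → Timely v
  completes-timely {v} (acc rec) =
    let c , fst , _ = first (horizon + suc n * slots n) (hears⇒Done (≤-trans (m≤m+n n _) (m≤m+n horizon _)) all-heard)
    in c , fst , first-bound (λ e → completes-timely (rec e)) fst
    where
    all-heard : ∀ u → Edge G u v → Hears (horizon + suc n * slots n) v u
    all-heard u e =
      let c , (k , _) , c≤ = completes-timely (rec e)
      in Any-H-mono (+-monoˡ-≤ _ (≤-trans c≤ (potential≤horizon c))) (round-robin-delivers k e)

  gathered : ∀ t → (∀ u → Reach G u t) → ∃ λ s → s ≤ horizon × Gathered protocol G t s
  gathered t reach =
    let c , (k , _) , c≤ = completes-timely (wf t)
    in c , ≤-trans c≤ (potential≤horizon c) , λ u → Done⇒holds (wf t) k u (reach u)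
    where
    wf : WellFounded (Edge G)
    wf = Edge-wellFounded acyclic

-- The size of the horizon

∑-geometric : ∀ {f} A m → (∀ j → f j ≤ A * 2 ^ j) → ∑ m f ≤ A * 2 ^ m
∑-geometric A zero    f≤ = z≤n
∑-geometric {f} A (suc m) f≤ = begin
  ∑ m f + f m             ≤⟨ +-mono-≤ (∑-geometric A m f≤) (f≤ m) ⟩
  A * 2 ^ m + A * 2 ^ m   ≡⟨ e A (2 ^ m) ⟩
  A * 2 ^ suc m           ∎
  where
  open ≤-Reasoning
  e : ∀ A x → A * x + A * x ≡ A * (x + (x + 0))
  e = solve-∀

module HorizonBound {n : ℕ} (2≤n : 2 ≤ n) where
  open ≤-Reasoning

  private
    ℓ = ⌈log₂ n ⌉
    L = slots n
    X = 2 ^ classes n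
    B = ℓ * ℓ * L * n

  1≤n : 1 ≤ n
  1≤n = ≤-trans (s≤s z≤n) 2≤n

  span≤ : ∀ j → span n (suc j) ≤ 9 * (ℓ * 2 ^ j * (ℓ * 2 ^ j)) * L
  span≤ j = *-monoˡ-≤ L (begin
    Q * Q                         ≤⟨ *-mono-≤ Q≤ Q≤ ⟩
    3 * M * (3 * M)               ≡⟨ e M ⟩
    9 * (M * M)                   ∎)
    where
    M = spread n j
    Q = moduli n j
    Q≤ : Q ≤ 3 * M
    Q≤ = +-monoˡ-≤ (2 * M) (*-mono-≤ (1≤⌈log₂⌉ 2≤n) (>-nonZero⁻¹ (2 ^ j) {{m^n≢0 2 j}}))
    e : ∀ M → 3 * M * (3 * M) ≡ 9 * (M * M)
    e = solve-∀

  -- Periods grow like `4 ^ j` while the number of groups falls like `n / 2 ^ j`, so the bound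
  -- doubles with `j`. The constant is 2 · 9 · 4, where 4 is the square of the factor 2 between
  -- strength and `quota`.
  cost≤ : ∀ j → cost n n j ≤ 72 * B * 2 ^ j
  cost≤ zero = begin
    2 * span n 1 * (n / 1)                        ≤⟨ *-mono-≤ (*-monoʳ-≤ 2 (span≤ 0)) (≤-reflexive (n/1≡n n)) ⟩
    2 * (9 * (ℓ * 1 * (ℓ * 1)) * L) * n           ≡⟨ e ℓ L n ⟩
    18 * B                                        ≤⟨ *-monoˡ-≤ B (m≤m+n 18 54) ⟩
    72 * B                                        ≡⟨ *-identityʳ (72 * B) ⟨
    72 * B * 1                                    ∎
    where
    e : ∀ ℓ L n → 2 * (9 * (ℓ * 1 * (ℓ * 1)) * L) * n ≡ 18 * (ℓ * ℓ * L * n)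
    e = solve-∀
  cost≤ (suc j) = begin
    2 * span n (suc (suc j)) * y                    ≤⟨ *-monoˡ-≤ y (*-monoʳ-≤ 2 (span≤ (suc j))) ⟩
    2 * (9 * (ℓ * (2 * x) * (ℓ * (2 * x))) * L) * y ≡⟨ e ℓ L x y ⟩
    72 * (ℓ * ℓ * L * (y * x)) * x
      ≤⟨ *-monoˡ-≤ x (*-monoʳ-≤ 72 (*-monoʳ-≤ (ℓ * ℓ * L) (m/n*n≤m n x {{m^n≢0 2 j}}))) ⟩
    72 * B * x                                      ≤⟨ *-monoʳ-≤ (72 * B) (m≤n*m x 2) ⟩
    72 * B * (2 * x)                                ∎
    where
    x = 2 ^ j
    y = share n (suc j)
    e : ∀ ℓ L x y → 2 * (9 * (ℓ * (2 * x) * (ℓ * (2 * x))) * L) * y ≡ 72 * (ℓ * ℓ * L * (y * x)) * x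
    e = solve-∀

  slots≤ : L ≤ 2 * ℓ
  slots≤ = ≤-trans (+-mono-≤ (1≤⌈log₂⌉ 2≤n) (⌈n/2⌉≤n ℓ)) (≤-reflexive (cong (ℓ +_) (sym (+-identityʳ ℓ))))

  4^classes≤ : X * X ≤ 4 * n
  4^classes≤ = begin
    X * X                          ≡⟨ ^-distribˡ-+-* 2 (classes n) (classes n) ⟨
    2 ^ (classes n + classes n)    ≤⟨ ^-monoʳ-≤ 2 (+-monoʳ-≤ (classes n) (⌊n/2⌋≤⌈n/2⌉ (suc ℓ))) ⟩
    2 ^ (classes n + ⌈ suc ℓ /2⌉)  ≡⟨ cong (2 ^_) (⌊n/2⌋+⌈n/2⌉≡n (suc ℓ)) ⟩
    2 * 2 ^ ℓ                      ≤⟨ *-monoʳ-≤ 2 (2^⌈log₂n⌉≤2n n {{>-nonZero 1≤n}}) ⟩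
    2 * (2 * n)                    ≡⟨ *-assoc 2 2 n ⟨
    4 * n                          ∎

  horizon≤ : n + ∑ (suc (classes n)) (cost n n) ≤ 290 * (ℓ * ℓ * ℓ * n * X)
  horizon≤ = begin
    n + ∑ (suc (classes n)) (cost n n)  ≤⟨ +-mono-≤ n≤BX (∑-geometric (72 * B) (suc (classes n)) cost≤) ⟩
    B * X + 72 * B * (2 * X)            ≡⟨ e B X ⟩
    145 * (B * X)                       ≤⟨ *-monoʳ-≤ 145 (*-monoˡ-≤ X (*-monoˡ-≤ n (*-monoʳ-≤ (ℓ * ℓ) slots≤))) ⟩
    145 * (ℓ * ℓ * (2 * ℓ) * n * X)     ≡⟨ e′ ℓ n X ⟩
    290 * (ℓ * ℓ * ℓ * n * X)           ∎
    where
    1≤ℓ : 1 ≤ ℓ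
    1≤ℓ = 1≤⌈log₂⌉ 2≤n
    n≤BX : n ≤ B * X
    n≤BX = begin
      n        ≤⟨ m≤n*m n (ℓ * ℓ * L) {{>-nonZero (*-mono-≤ (*-mono-≤ 1≤ℓ 1≤ℓ) (s≤s z≤n))}} ⟩
      B        ≤⟨ m≤m*n B X {{m^n≢0 2 (classes n)}} ⟩
      B * X    ∎
    e : ∀ B X → B * X + 72 * B * (2 * X) ≡ 145 * (B * X)
    e = solve-∀
    e′ : ∀ ℓ n X → 145 * (ℓ * ℓ * (2 * ℓ) * n * X) ≡ 290 * (ℓ * ℓ * ℓ * n * X)
    e′ = solve-∀

  -- Squaring keeps the exponent 3/2 within the natural numbers; `X * X` is at most `4 * n`.
  square≤ : ∀ {s k} → s ≤ k * (ℓ * ℓ * ℓ * n * X) → s * s ≤ 4 * (k * k) * (n ^ 3 * ℓ ^ 6)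
  square≤ {s} {k} s≤ = begin
    s * s                                 ≤⟨ *-mono-≤ s≤ s≤ ⟩
    k * (ℓ * ℓ * ℓ * n * X) * (k * (ℓ * ℓ * ℓ * n * X)) ≡⟨ e k ℓ n X ⟩
    k * k * (ℓ ^ 6 * n ^ 2 * (X * X))     ≤⟨ *-monoʳ-≤ (k * k) (*-monoʳ-≤ (ℓ ^ 6 * n ^ 2) 4^classes≤) ⟩
    k * k * (ℓ ^ 6 * n ^ 2 * (4 * n))     ≡⟨ e′ k (ℓ ^ 6) n ⟩
    4 * (k * k) * (n ^ 3 * ℓ ^ 6)         ∎
    where
    e : ∀ k ℓ n X → k * (ℓ * ℓ * ℓ * n * X) * (k * (ℓ * ℓ * ℓ * n * X)) 
        ≡ k * k * (ℓ * (ℓ * (ℓ * (ℓ * (ℓ * (ℓ * 1))))) * (n * (n * 1)) * (X * X))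
    e = solve-∀
    e′ : ∀ k y n → k * k * (y * (n * (n * 1)) * (4 * n)) ≡ 4 * (k * k) * (n * (n * (n * 1)) * y)
    e′ = solve-∀

theorem1 : Σ Protocol λ P → Σ ℕ λ c → Σ ℕ λ n₀ →
    ∀ n → n₀ ≤ n → (G : Graph n) → Acyclic G → (t : Fin n) →
    (∀ u → Reach G u t) →
    Σ ℕ λ s → (s * s ≤ c * (n ^ 3 * ⌈log₂ n ⌉ ^ 6)) × Gathered P G t s
-- The constant is `4 * (k * k)` from `square≤` at `k` = 290; `n` from 2 on makes the logarithm
-- positive.
theorem1 = protocol , 4 * (290 * 290) , 2 , λ n 2≤n G acyclic t reach →
  let s , s≤ , done = Analysis.gathered 2≤n G acyclic t reach
  in s , HorizonBound.square≤ 2≤n {k = 290} (≤-trans s≤ (HorizonBound.horizon≤ 2≤n)) , done
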